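{- Let $L$ be a finite lattice. Then $L$ is matroidal if and only if $L$ is a linear order, i.e. $L\cong[n]$ (as a poset) for some integer $n\ge 0$.
   Context: Lattices are nonempty. For $n\ge 0$, $[n]$ denotes the linearly ordered set $\{0<1<\dots<n\}$. For a finite lattice $L$ with order $\le$ and meet $\wedge$, $L^\to$ denotes the set of nontrivial edges of $L$, i.e. pairs $(x\to y)$ with $x,y\in L$, $x\le y$ and $x\ne y$. A transfer system on $L$ is a partial order $T$ on the set $L$ that is contained in $\le$ (so $T$ is reflexive, transitive, and $x\,T\,y$ implies $x\le y$) and is closed under restriction: if $x\,T\,y$ and $z\in L$, then $(x\wedge z)\,T\,(y\wedge z)$. For every set $S\subseteq L^\to$ there is a smallest transfer system containing $S$, called the transfer system generated by $S$. A set $S\subseteq L^\to$ is a minimal generating set if no proper subset of $S$ generates the same transfer system as $S$. $\mathrm{MGS}(L)\subseteq\mathcal P(L^\to)$ denotes the collection of all minimal generating sets (of all transfer systems on $L$). A matroid is a pair $(E,I)$ with $E$ a finite set and $I\subseteq\mathcal P(E)$ such that: (1) $\emptyset\in I$; (2) if $A\subseteq B$ and $B\in I$, then $A\in I$; (3) if $A,B\in I$ with $|A|<|B|$, then there is some $b\in B\setminus A$ such that $A\cup\{b\}\in I$. The lattice $L$ is called matroidal if the pair $(L^\to,\mathrm{MGS}(L))$ is a matroid. -}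

module Defs where

open import Algebra.Core using (Op₂)
import Data.Bool.Base as Bool
open import Data.Bool.Base using (Bool; false; T)
import Data.Fin.Base as Fin
open import Data.Fin.Base using (Fin)
import Data.Fin.Properties as Fin
import Data.Fin.Subset as Fin
open import Data.Nat.Base using (ℕ; suc; _<_)
open import Data.Product.Base using (∃; _×_; _,_; proj₁; proj₂)
open import Data.Vec.Base using (tabulate)
open import Function.Base using (_∘_)
open import Function.Bundles using (_↔_; Inverse)
open import Function.Properties.Inverse using (↔⇒↣)
open import Level using (Level; _⊔_) renaming (suc to lsuc)
open import Relation.Binary.Core using (Rel; _⇒_)
open import Relation.Binary.Definitions using (DecidableEquality; Decidable)
open import Relation.Binary.Lattice.Structures using (IsLattice)
open import Relation.Binary.Morphism.Structures using (IsOrderIsomorphism)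
open import Relation.Binary.PropositionalEquality
  using (_≡_; _≢_; refl; subst; isEquivalence)
open import Relation.Binary.Structures using (IsPartialOrder)
open import Relation.Nullary using (¬_; does; recompute)
open import Relation.Nullary.Decidable using (map′)
open import Relation.Unary using (Pred; _∈_; _∉_; _⊆_; _⊂_)

private
  variable
    c e i ℓ : Level

Finite : Set e → Set e
Finite E = ∃ λ (n : ℕ) → E ↔ Fin n

module FiniteSet {E : Set e} (finite : Finite E) where

  open Inverse (proj₂ finite) public using (to; from)

  infix 4 _≟_
  _≟_ : DecidableEquality E
  _≟_ = Fin.inj⇒≟ (↔⇒↣ (proj₂ finite))

-- Subsets of finite sets are given by their characteristic functions.
Subset : Set e → Set e
Subset E = E → Bool

⟦_⟧ : {E : Set e} → Subset E → Pred E Level.zero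
⟦ A ⟧ x = T (A x)

∅ : {E : Set e} → Subset E
∅ _ = false

module FiniteSubset {E : Set e} (finite : Finite E) where

  open FiniteSet finite

  ∣_∣ : Subset E → ℕ
  ∣ A ∣ = Fin.∣ tabulate (A ∘ from) ∣

  infixl 6 _∪⁅_⁆
  _∪⁅_⁆ : Subset E → E → Subset E
  (A ∪⁅ b ⁆) x = A x Bool.∨ does (x ≟ b)

record IsMatroid (E : Set e) (I : Pred (Subset E) i) : Set (e ⊔ i) where
  field
    finite : Finite E

  open FiniteSubset finite public

  field
    empty      : I ∅
    hereditary : ∀ {A B} → ⟦ A ⟧ ⊆ ⟦ B ⟧ → I B → I A
    exchange   : ∀ {A B} → I A → I B → ∣ A ∣ < ∣ B ∣ →
                 ∃ λ b → b ∈ ⟦ B ⟧ × b ∉ ⟦ A ⟧ × I (A ∪⁅ b ⁆)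

record FiniteLattice c ℓ : Set (lsuc (c ⊔ ℓ)) where
  infix  4 _≤_
  infixr 6 _∨_
  infixr 7 _∧_
  field
    Carrier   : Set c
    _≤_       : Rel Carrier ℓ
    _∨_       : Op₂ Carrier
    _∧_       : Op₂ Carrier
    isLattice : IsLattice _≡_ _≤_ _∨_ _∧_
    finite    : Finite Carrier
    nonempty  : Carrier

  open IsLattice isLattice public
    using (isPartialOrder; antisym; infimum)
    renaming (refl to ≤-refl; trans to ≤-trans)
  open FiniteSet finite public using (_≟_)

  infix 4 _≤?_
  _≤?_ : Decidable _≤_
  x ≤? y = map′
    (λ x∧y≡x → subst (_≤ y) x∧y≡x (proj₁ (proj₂ (infimum x y))))
    (λ x≤y → antisym (proj₁ (infimum x y))
                     (proj₂ (proj₂ (infimum x y)) x ≤-refl x≤y))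
    (x ∧ y ≟ x)

module _ (L : FiniteLattice c ℓ) where

  open FiniteLattice L

  -- The last two fields are irrelevant, so that an edge is determined by its
  -- endpoints even if _≤_ is not proof-irrelevant; edge⇒≤ recovers the
  -- inequality.
  record Edge : Set (c ⊔ ℓ) where
    constructor edge
    field
      source : Carrier
      target : Carrier
      .source≤target : source ≤ target
      .source≢target : source ≢ target

  edge⇒≤ : (a : Edge) → Edge.source a ≤ Edge.target a
  edge⇒≤ (edge x y x≤y _) = recompute (x ≤? y) x≤y

  record IsTransferSystem (R : Rel Carrier (c ⊔ ℓ)) : Set (c ⊔ ℓ) where
    field
      isPartialOrder : IsPartialOrder _≡_ R
      contained      : R ⇒ _≤_
      restrict       : ∀ {x y} z → R x y → R (x ∧ z) (y ∧ z)

  Contains : Rel Carrier (c ⊔ ℓ) → Subset Edge → Set (c ⊔ ℓ)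
  Contains R S = ∀ {a} → a ∈ ⟦ S ⟧ → R (Edge.source a) (Edge.target a)

  record Generates (S : Subset Edge) (R : Rel Carrier (c ⊔ ℓ))
                   : Set (lsuc (c ⊔ ℓ)) where
    field
      isTransferSystem : IsTransferSystem R
      contains         : Contains R S
      smallest         : ∀ {R′} → IsTransferSystem R′ → Contains R′ S → R ⇒ R′

  GenerateSame : Subset Edge → Subset Edge → Set (lsuc (c ⊔ ℓ))
  GenerateSame S S′ = ∃ λ R → Generates S R × Generates S′ R

  MGS : Pred (Subset Edge) (lsuc (c ⊔ ℓ))
  MGS S = ∀ S′ → ⟦ S′ ⟧ ⊂ ⟦ S ⟧ → ¬ GenerateSame S′ S

  Matroidal : Set (lsuc (c ⊔ ℓ))
  Matroidal = IsMatroid Edge MGS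

  IsLinearOrder : Set (c ⊔ ℓ)
  IsLinearOrder = ∃ λ (n : ℕ) → ∃ λ (f : Carrier → Fin (suc n)) →
    IsOrderIsomorphism _≡_ _≡_ _≤_ Fin._≤_ f

  -- Every set of edges generates a transfer system, so GenerateSame is not
  -- vacuous.
  data Closure (S : Subset Edge) : Rel Carrier (c ⊔ ℓ) where
    generator : ∀ {a} → a ∈ ⟦ S ⟧ → Closure S (Edge.source a) (Edge.target a)
    reflexive : ∀ {x} → Closure S x x
    compose   : ∀ {x y z} → Closure S x y → Closure S y z → Closure S x z
    restrict  : ∀ {x y} z → Closure S x y → Closure S (x ∧ z) (y ∧ z)

  closure⇒≤ : ∀ {S} → Closure S ⇒ _≤_
  closure⇒≤ (generator {a} _) = edge⇒≤ a
  closure⇒≤ reflexive         = ≤-refl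
  closure⇒≤ (compose p q)     = ≤-trans (closure⇒≤ p) (closure⇒≤ q)
  closure⇒≤ (restrict {x} {y} z p) =
    proj₂ (proj₂ (infimum y z)) (x ∧ z)
      (≤-trans (proj₁ (infimum x z)) (closure⇒≤ p))
      (proj₁ (proj₂ (infimum x z)))

  closure-generates : ∀ S → Generates S (Closure S)
  closure-generates S = record
    { isTransferSystem = record
      { isPartialOrder = record
        { isPreorder = record
          { isEquivalence = isEquivalence
          ; reflexive     = λ { refl → reflexive }
          ; trans         = compose
          }
        ; antisym = λ p q → antisym (closure⇒≤ p) (closure⇒≤ q)
        }
      ; contained = closure⇒≤
      ; restrict  = restrict
      }
    ; contains = generator
    ; smallest = least
    }
    where
    least : ∀ {R} → IsTransferSystem R → Contains R S → Closure S ⇒ R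
    least t s (generator p)  = s p
    least t s reflexive      = IsPartialOrder.refl (IsTransferSystem.isPartialOrder t)
    least t s (compose p q)  =
      IsPartialOrder.trans (IsTransferSystem.isPartialOrder t) (least t s p) (least t s q)
    least t s (restrict z p) = IsTransferSystem.restrict t z (least t s p)

{-# OPTIONS --safe #-}

-- On a linear order, restriction only shortens an edge while keeping its
-- source, or trivialises it.  Hence the shorter of two edges with a common
-- source is redundant, and an edge cannot be produced from edges with other
-- sources: the minimal generating sets are the sets with at most one edge per
-- source, which form a partition matroid.  Conversely, for incomparable x and
-- y with meet m and join j, the single edge m → j restricts to both m → x and
-- m → y, whereas the latter two are independent of each other; so {m → j}
-- cannot be enlarged by an element of {m → x , m → y}, and exchange fails.
module Submission where

open import Defs
open import Level using (Level)
open import Function.Bundles using (_⇔_)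

open import Data.Bool.Base using (true; false; T)
import Data.Bool.Base as Bool
open import Data.Bool.Properties using (T?; T-∨; T-∧)
open import Data.Empty using (⊥-elim-irr)
open import Data.Fin.Base as Fin using (Fin; zero; suc; punchOut)
import Data.Fin.Properties as Fin
import Data.Fin.Subset as Fin
open import Data.List.Base as List
  using (List; []; _∷_; length; lookup; filter; concatMap; cartesianProduct; deduplicate)
open import Data.List.Membership.Propositional as List using (find; lose)
open import Data.List.Membership.Propositional.Properties
  using (∈-lookup; ∈-map⁺; ∈-filter⁺; ∈-filter⁻; ∈-tabulate⁺; ∈-concatMap⁺;
         ∈-cartesianProduct⁺; ∈-deduplicate⁺)
open import Data.List.Membership.Setoid.Properties using (index-injective)
open import Data.List.Properties using (length-map; length-tabulate)
import Data.List.Relation.Unary.All as All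
open import Data.List.Relation.Unary.All using ([]; _∷_)
open import Data.List.Relation.Unary.All.Properties using (¬All⇒Any¬)
open import Data.List.Relation.Unary.AllPairs using ([]; _∷_)
open import Data.List.Relation.Unary.Any using (here; there; index; any?)
open import Data.List.Relation.Unary.Any.Properties using (lookup-index)
open import Data.List.Relation.Unary.Unique.DecPropositional.Properties using (deduplicate-!)
open import Data.List.Relation.Unary.Unique.Propositional using (Unique)
open import Data.List.Relation.Unary.Unique.Propositional.Properties
  renaming (filter⁺ to Unique-filter⁺; tabulate⁺ to Unique-tabulate⁺)
import Data.Nat.Base as ℕ
import Data.Nat.Properties as ℕ
open import Data.Product.Base using (∃; _×_; _,_; proj₁; proj₂)
open import Data.Sum.Base using (_⊎_; inj₁; inj₂)
import Data.Vec.Base as Vec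
open import Function.Base using (_∘_; id)
open import Function.Bundles using (mk⇔; mk↔ₛ′; Equivalence; Inverse; Injection)
open import Function.Definitions using (Injective; Surjective)
open import Function.Properties.Inverse using (↔⇒↣; ↔-sym)
open import Relation.Binary.Core using (Rel)
open import Relation.Binary.Definitions using (DecidableEquality; Total)
open import Relation.Binary.Lattice.Bundles using (Lattice)
import Relation.Binary.Lattice.Properties.MeetSemilattice as MeetSemilatticeProperties
open import Relation.Binary.Morphism.Structures using (IsOrderIsomorphism)
open import Relation.Binary.PropositionalEquality
open import Relation.Nullary
open import Relation.Nullary.Decidable using (map′; decidable-stable; _×-dec_; ¬?)
open import Relation.Unary using (_∈_; _∉_; _⊆_)

private
  variable
    a b c ℓ p : Level
    A : Set a
    B : Set b
    P : Set p

-- Counting with lists and finite types.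

T-does⁺ : (P? : Dec P) → P → T (does P?)
T-does⁺ (yes _) _ = _
T-does⁺ (no ¬q) q = ¬q q

T-does⁻ : (P? : Dec P) → T (does P?) → P
T-does⁻ (yes q) _ = q

-- Pigeonhole: if `j` were missed, punching it out of the codomain would inject a set of `suc n`
-- elements into one of `n`.
injective⇒surjective : ∀ {n} {f : Fin n → Fin n} → Injective _≡_ _≡_ f → ∀ j → ∃ λ i → f i ≡ j
injective⇒surjective {ℕ.suc n} {f} f-injective j =
  decidable-stable (Fin.any? (λ i → f i Fin.≟ j)) λ missed →
    let j≢f i eq = missed (i , sym eq) in
    ℕ.1+n≰n (Fin.injective⇒≤ {f = λ i → punchOut (j≢f i)}
      (f-injective ∘ Fin.punchOut-injective (j≢f _) (j≢f _)))

Unique⇒lookup-injective : {xs : List A} → Unique xs → Injective _≡_ _≡_ (lookup xs)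
Unique⇒lookup-injective {xs = _ ∷ _}  _          {zero}  {zero}  _  = refl
Unique⇒lookup-injective {xs = _ ∷ xs} (x∉xs ∷ _) {zero}  {suc j} eq =
  contradiction eq (All.lookup x∉xs (∈-lookup j))
Unique⇒lookup-injective {xs = _ ∷ xs} (x∉xs ∷ _) {suc i} {zero}  eq =
  contradiction (sym eq) (All.lookup x∉xs (∈-lookup i))
Unique⇒lookup-injective {xs = _ ∷ _}  (_ ∷ xs!)  {suc i} {suc j} eq =
  cong suc (Unique⇒lookup-injective xs! eq)

-- Each position in `xs` is sent to a position of its image in `ys`; uniqueness of `xs` makes this
-- map between `Fin`s injective.
length-injectiveOn : {xs : List A} {ys : List B} (f : A → B) → Unique xs →
  (∀ {x} → x List.∈ xs → f x List.∈ ys) →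
  (∀ {x x′} → x List.∈ xs → x′ List.∈ xs → f x ≡ f x′ → x ≡ x′) →
  length xs ℕ.≤ length ys
length-injectiveOn f xs! f∈ f-injective = Fin.injective⇒≤ {f = λ i → index (f∈ (∈-lookup i))}
  λ {i} {j} eq → Unique⇒lookup-injective xs! (f-injective (∈-lookup i) (∈-lookup j)
    (index-injective (setoid _) (f∈ (∈-lookup i)) (f∈ (∈-lookup j)) eq))

-- The list may repeat elements; after deduplication, taking the position and looking it up are
-- mutually inverse.
enumerable⇒Finite : DecidableEquality A → (xs : List A) → (∀ x → x List.∈ xs) → Finite A
enumerable⇒Finite {A = A} _≟_ xs complete = length ys , mk↔ₛ′ (index ∘ complete′) (lookup ys)
  (λ i → Unique⇒lookup-injective (deduplicate-! _≟_ xs) (sym (lookup-index (complete′ (lookup ys i)))))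
  (λ x → sym (lookup-index (complete′ x)))
  where
  ys : List A
  ys = deduplicate _≟_ xs

  complete′ : ∀ x → x List.∈ ys
  complete′ x = ∈-deduplicate⁺ _≟_ (complete x)

-- This turns the vector-based cardinality into the length of a list, so that the counting lemmas
-- for lists apply.
∣tabulate∣ : ∀ {n} (S : Subset A) (f : Fin n → A) →
  Fin.∣ Vec.tabulate (S ∘ f) ∣ ≡ length (filter (T? ∘ S) (List.tabulate f))
∣tabulate∣ {n = ℕ.zero}  S f = refl
∣tabulate∣ {n = ℕ.suc n} S f with S (f zero)
... | true  = cong ℕ.suc (∣tabulate∣ S (f ∘ suc))
... | false = ∣tabulate∣ S (f ∘ suc)

-- Cardinality of subsets of a finite set.

module FiniteSubsetProperties {E : Set a} (finite : Finite E) where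

  open FiniteSet finite
  open FiniteSubset finite

  universe : List E
  universe = List.tabulate from

  ∈-universe : ∀ x → x List.∈ universe
  ∈-universe x = subst (List._∈ universe) (Inverse.strictlyInverseʳ (proj₂ finite) x)
    (∈-tabulate⁺ (to x))

  elements : Subset E → List E
  elements S = filter (T? ∘ S) universe

  elements-! : ∀ S → Unique (elements S)
  elements-! S = Unique-filter⁺ (T? ∘ S)
    (Unique-tabulate⁺ (Injection.injective (↔⇒↣ (↔-sym (proj₂ finite)))))

  ∈-elements⁺ : ∀ {S x} → x ∈ ⟦ S ⟧ → x List.∈ elements S
  ∈-elements⁺ {S} x∈S = ∈-filter⁺ (T? ∘ S) (∈-universe _) x∈S

  ∈-elements⁻ : ∀ {S x} → x List.∈ elements S → x ∈ ⟦ S ⟧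
  ∈-elements⁻ {S} = proj₂ ∘ ∈-filter⁻ (T? ∘ S) {xs = universe}

  ∣∣≡length : ∀ S → ∣ S ∣ ≡ length (elements S)
  ∣∣≡length S = ∣tabulate∣ S from

  length≤∣∣ : ∀ {xs} S → Unique xs → (∀ {x} → x List.∈ xs → x ∈ ⟦ S ⟧) → length xs ℕ.≤ ∣ S ∣
  length≤∣∣ S xs! xs⊆S rewrite ∣∣≡length S =
    length-injectiveOn id xs! (∈-elements⁺ {S} ∘ xs⊆S) (λ _ _ → id)

  ∣∣≤length : ∀ S {xs : List B} (f : E → B) →
    (∀ {x} → x ∈ ⟦ S ⟧ → f x List.∈ xs) →
    (∀ {x y} → x ∈ ⟦ S ⟧ → y ∈ ⟦ S ⟧ → f x ≡ f y → x ≡ y) → ∣ S ∣ ℕ.≤ length xs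
  ∣∣≤length S f f∈ f-injective rewrite ∣∣≡length S =
    length-injectiveOn f (elements-! S) (f∈ ∘ ∈-elements⁻ {S})
      (λ x∈ y∈ → f-injective (∈-elements⁻ {S} x∈) (∈-elements⁻ {S} y∈))

  ∣∣<∣∣ : ∀ {S S′ x} → ⟦ S ⟧ ⊆ ⟦ S′ ⟧ → x ∈ ⟦ S′ ⟧ → x ∉ ⟦ S ⟧ → ∣ S ∣ ℕ.< ∣ S′ ∣
  ∣∣<∣∣ {S} {S′} {x} S⊆S′ x∈S′ x∉S rewrite ∣∣≡length S =
    -- Prepending `x` to the elements of `S` keeps the list free of repetitions and inside `S′`.
    length≤∣∣ S′ (All.tabulate (λ y∈ x≡y → x∉S (∈-elements⁻ {S} (subst (List._∈ elements S) (sym x≡y) y∈)))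
                  ∷ elements-! S)
      λ { (here refl) → x∈S′ ; (there y∈) → S⊆S′ (∈-elements⁻ {S} y∈) }

  ∪⁅⁆⁺ˡ : ∀ S x {y} → y ∈ ⟦ S ⟧ → y ∈ ⟦ S ∪⁅ x ⁆ ⟧
  ∪⁅⁆⁺ˡ S x y∈S = Equivalence.from T-∨ (inj₁ y∈S)

  ∪⁅⁆⁺ʳ : ∀ S x → x ∈ ⟦ S ∪⁅ x ⁆ ⟧
  ∪⁅⁆⁺ʳ S x = Equivalence.from (T-∨ {S x}) (inj₂ (T-does⁺ (x ≟ x) refl))

  ∪⁅⁆⁻ : ∀ S x {y} → y ∈ ⟦ S ∪⁅ x ⁆ ⟧ → y ∈ ⟦ S ⟧ ⊎ y ≡ x
  ∪⁅⁆⁻ S x {y} y∈ with Equivalence.to (T-∨ {S y}) y∈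
  ... | inj₁ y∈S = inj₁ y∈S
  ... | inj₂ y≡x = inj₂ (T-does⁻ (y ≟ x) y≡x)

  -- The exchange property of a partition matroid with blocks the fibres of `f`: if `S` met every
  -- fibre that `S′` meets, injectivity on `S′` would give `∣ S′ ∣ ≤ ∣ S ∣`.
  exchange-injectiveOn : DecidableEquality B → (f : E → B) → ∀ {S S′} →
    (∀ {x y} → x ∈ ⟦ S′ ⟧ → y ∈ ⟦ S′ ⟧ → f x ≡ f y → x ≡ y) → ∣ S ∣ ℕ.< ∣ S′ ∣ →
    ∃ λ x → x ∈ ⟦ S′ ⟧ × (∀ {y} → y ∈ ⟦ S ⟧ → f y ≢ f x)
  exchange-injectiveOn _≟ᶠ_ f {S} {S′} f-injective ∣S∣<∣S′∣
    with All.all? (λ x → any? (f x ≟ᶠ_) (List.map f (elements S))) (elements S′)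
  ... | yes covered = contradiction
    (ℕ.≤-trans (∣∣≤length S′ f (λ x∈S′ → All.lookup covered (∈-elements⁺ {S′} x∈S′)) f-injective)
      (ℕ.≤-reflexive (trans (length-map f (elements S)) (sym (∣∣≡length S)))))
    (ℕ.<⇒≱ ∣S∣<∣S′∣)
  ... | no ¬covered with find (¬All⇒Any¬ (λ x → any? (f x ≟ᶠ_) (List.map f (elements S))) _ ¬covered)
  ...   | x , x∈ , fx∉ = x , ∈-elements⁻ {S′} x∈ ,
    λ y∈S fy≡fx → fx∉ (subst (List._∈ List.map f (elements S)) fy≡fx (∈-map⁺ f (∈-elements⁺ {S} y∈S)))

-- Edges of a finite lattice.

module _ (L : FiniteLattice c ℓ) where

  open FiniteLattice L

  lattice : Lattice c c ℓ
  lattice = record { isLattice = isLattice }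

  open Lattice lattice using (meetSemilattice; x∧y≤x; x∧y≤y; x≤x∨y; y≤x∨y)
  open MeetSemilatticeProperties meetSemilattice using (∧-comm; ∧-assoc; ∧-idempotent; y≤x⇒x∧y≈y; ∧-monotonic)

  x≤y⇒x∧y≡x : ∀ {x y} → x ≤ y → x ∧ y ≡ x
  x≤y⇒x∧y≡x x≤y = trans (∧-comm _ _) (y≤x⇒x∧y≈y x≤y)

  source target : Edge L → Carrier
  source = Edge.source
  target = Edge.target

  source≢target : (e : Edge L) → source e ≢ target e
  source≢target (edge _ _ _ x≢y) x≡y = ⊥-elim-irr (x≢y x≡y)

  edge-≡ : ∀ {e f : Edge L} → source e ≡ source f → target e ≡ target f → e ≡ f
  edge-≡ {edge _ _ _ _} {edge _ _ _ _} refl refl = refl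

  infix 4 _≟ᵉ_
  _≟ᵉ_ : DecidableEquality (Edge L)
  e ≟ᵉ f = map′ (λ (s , t) → edge-≡ s t) (λ { refl → refl , refl })
    ((source e ≟ source f) ×-dec (target e ≟ target f))

  edgesBetween : Carrier × Carrier → List (Edge L)
  edgesBetween (x , y) with x ≤? y | x ≟ y
  ... | yes x≤y | no x≢y = edge x y x≤y x≢y ∷ []
  ... | _       | _      = []

  ∈-edgesBetween : ∀ e → e List.∈ edgesBetween (source e , target e)
  ∈-edgesBetween e with source e ≤? target e | source e ≟ target e
  ... | yes _  | no _   = here refl
  ... | yes _  | yes eq = contradiction eq (source≢target e)
  ... | no x≰y | _      = contradiction (edge⇒≤ L e) x≰y

  edge-finite : Finite (Edge L)
  edge-finite = enumerable⇒Finite _≟ᵉ_ (concatMap edgesBetween (cartesianProduct universe universe))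
    λ e → ∈-concatMap⁺ edgesBetween
      (lose (∈-cartesianProduct⁺ (∈-universe (source e)) (∈-universe (target e))) (∈-edgesBetween e))
    where open FiniteSubsetProperties finite

  -- Criteria for minimality of generating sets.

  ≤-isTransferSystem : {R : Rel Carrier (c Level.⊔ ℓ)} →
    (∀ {x y} → R x y → x ≤ y) → (∀ {x} → R x x) → (∀ {x y z} → R x y → R y z → R x z) →
    (∀ {x y} z → R x y → R (x ∧ z) (y ∧ z)) → IsTransferSystem L R
  ≤-isTransferSystem R⇒≤ R-refl R-trans R-restrict = record
    { isPartialOrder = record
      { isPreorder = record
        { isEquivalence = isEquivalence
        ; reflexive     = λ { refl → R-refl }
        ; trans         = R-trans
        }
      ; antisym = λ xRy yRx → antisym (R⇒≤ xRy) (R⇒≤ yRx)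
      }
    ; contained = R⇒≤
    ; restrict  = R-restrict
    }

  -- Each `e` has a transfer system containing all other edges of `S` but not `e`. It contains
  -- whatever a subset of `S` without `e` generates, so such a subset cannot recover `e`.
  separated⇒MGS : ∀ {S} → (∀ {e} → e ∈ ⟦ S ⟧ → ∃ λ R → IsTransferSystem L R ×
    (∀ {f} → f ∈ ⟦ S ⟧ → f ≢ e → R (source f) (target f)) × ¬ R (source e) (target e)) → MGS L S
  separated⇒MGS separate S′ (S′⊆S , S⊈S′) (_ , S′-generates , S-generates) =
    -- Properness is refuted by showing `S` contained in `S′`; membership is decidable, so a missing
    -- `e` may be assumed.
    S⊈S′ λ {e} e∈S → decidable-stable (T? (S′ e)) λ e∉S′ →
      let _ , isTS , others , ¬Re = separate e∈S in
      ¬Re (Generates.smallest S′-generates isTS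
        (λ f∈S′ → others (S′⊆S f∈S′) λ { refl → e∉S′ f∈S′ })
        (Generates.contains S-generates e∈S))

  -- The separating transfer system identifies the ends of an edge after meeting with `target e`.
  -- For `e` itself this would force `source e` to equal `target e`.
  ∧-agreeing⇒MGS : ∀ {S} → (∀ {e f} → e ∈ ⟦ S ⟧ → f ∈ ⟦ S ⟧ → f ≢ e →
    source f ∧ target e ≡ target f ∧ target e) → MGS L S
  ∧-agreeing⇒MGS agree = separated⇒MGS λ {e} e∈S →
    (λ x y → x ≤ y × x ∧ target e ≡ y ∧ target e) ,
    ≤-isTransferSystem proj₁ (≤-refl , refl)
      (λ (p , p′) (q , q′) → ≤-trans p q , trans p′ q′)
      (λ z (p , p′) → ∧-monotonic p ≤-refl ,
        trans (swap z) (trans (cong (_∧ z) p′) (sym (swap z)))) ,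
    (λ {f} f∈S f≢e → edge⇒≤ L f , agree {e} {f} e∈S f∈S f≢e) ,
    λ (s≤t , eq) → source≢target e (trans (sym (x≤y⇒x∧y≡x s≤t)) (trans eq (∧-idempotent _)))
    where
    swap : ∀ {x y} z → (x ∧ z) ∧ y ≡ (x ∧ y) ∧ z
    swap {x} {y} z = trans (∧-assoc x z y) (trans (cong (x ∧_) (∧-comm z y)) (sym (∧-assoc x y z)))

  restriction⇒¬MGS : ∀ {S e f} → e ∈ ⟦ S ⟧ → f ∈ ⟦ S ⟧ → e ≢ f →
    source f ∧ target e ≡ source e → target f ∧ target e ≡ target e → ¬ MGS L S
  restriction⇒¬MGS {S} {e} {f} e∈S f∈S e≢f s t S-mgs = S-mgs S∖e
    ((λ g∈ → proj₁ (S∖e⁻ g∈)) , λ S⊆S∖e → proj₂ (S∖e⁻ (S⊆S∖e e∈S)) refl)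
    (Closure L S∖e , closure-generates L S∖e , record
      { isTransferSystem = Generates.isTransferSystem (closure-generates L S∖e)
      ; contains         = contains
      ; smallest         = λ isTS R-contains →
          Generates.smallest (closure-generates L S∖e) isTS (λ g∈ → R-contains (proj₁ (S∖e⁻ g∈)))
      })
    where
    S∖e : Subset (Edge L)
    S∖e g = S g Bool.∧ does (¬? (g ≟ᵉ e))

    S∖e⁻ : ∀ {g} → g ∈ ⟦ S∖e ⟧ → g ∈ ⟦ S ⟧ × g ≢ e
    S∖e⁻ {g} g∈ with Equivalence.to (T-∧ {S g}) g∈
    ... | g∈S , g≢e = g∈S , T-does⁻ (¬? (g ≟ᵉ e)) g≢e

    S∖e⁺ : ∀ {g} → g ∈ ⟦ S ⟧ → g ≢ e → g ∈ ⟦ S∖e ⟧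
    S∖e⁺ {g} g∈S g≢e = Equivalence.from (T-∧ {S g}) (g∈S , T-does⁺ (¬? (g ≟ᵉ e)) g≢e)

    contains : Contains L (Closure L S∖e) S
    contains {g} g∈S with g ≟ᵉ e
    ... | yes refl = subst₂ (Closure L S∖e) s t
      (restrict (target e) (generator (S∖e⁺ f∈S (e≢f ∘ sym))))
    ... | no g≢e   = generator (S∖e⁺ g∈S g≢e)

  -- Linear orders are matroidal.

  module _ (total : Total _≤_) where

    SourceInjective : Subset (Edge L) → Set _
    SourceInjective S = ∀ {e f} → e ∈ ⟦ S ⟧ → f ∈ ⟦ S ⟧ → source e ≡ source f → e ≡ f

    sourceInjective⇒MGS : ∀ {S} → SourceInjective S → MGS L S
    sourceInjective⇒MGS injective = separated⇒MGS λ {e} e∈S →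
      -- The separating transfer system has every edge of the lattice except those starting at
      -- `source e`.
      (λ x y → x ≤ y × (x ≡ source e → y ≡ x)) ,
      ≤-isTransferSystem proj₁ (≤-refl , λ _ → refl)
        (λ (p , p′) (q , q′) → ≤-trans p q ,
          λ x≡s → trans (q′ (trans (p′ x≡s) x≡s)) (p′ x≡s))
        (λ z (p , p′) → ∧-monotonic p ≤-refl , stationary z p p′) ,
      (λ {f} f∈S f≢e → edge⇒≤ L f , λ s≡s → contradiction (injective f∈S e∈S s≡s) f≢e) ,
      λ (_ , fixed) → source≢target e (sym (fixed refl))
      where
      -- If `x ≤ z`, the meet leaves `x` in place, so `x` is `s` and the edge was already trivial.
      -- If `z ≤ x`, both ends collapse to `z`.
      stationary : ∀ {s x y} z → x ≤ y → (x ≡ s → y ≡ x) → x ∧ z ≡ s → y ∧ z ≡ x ∧ z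
      stationary {s} {x} {y} z x≤y fixed x∧z≡s with total x z
      ... | inj₁ x≤z = cong (_∧ z) (fixed (trans (sym (x≤y⇒x∧y≡x x≤z)) x∧z≡s))
      ... | inj₂ z≤x = trans (y≤x⇒x∧y≈y (≤-trans z≤x x≤y)) (sym (y≤x⇒x∧y≈y z≤x))

    -- Targets are comparable, and of two edges with a common source the one with the smaller target
    -- is a restriction of the other.
    MGS⇒sourceInjective : ∀ {S} → MGS L S → SourceInjective S
    MGS⇒sourceInjective {S} S-mgs {e} {f} e∈S f∈S s≡s = decidable-stable (e ≟ᵉ f) distinct
      where
      distinct : ¬ e ≢ f
      distinct e≢f with total (target e) (target f)
      ... | inj₁ te≤tf = restriction⇒¬MGS {S} e∈S f∈S e≢f
        (trans (cong (_∧ target e) (sym s≡s)) (x≤y⇒x∧y≡x (edge⇒≤ L e))) (y≤x⇒x∧y≈y te≤tf) S-mgs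
      ... | inj₂ tf≤te = restriction⇒¬MGS {S} f∈S e∈S (e≢f ∘ sym)
        (trans (cong (_∧ target f) s≡s) (x≤y⇒x∧y≡x (edge⇒≤ L f))) (y≤x⇒x∧y≈y tf≤te) S-mgs

    total⇒matroidal : Matroidal L
    total⇒matroidal = record
      { finite     = edge-finite
      ; empty      = sourceInjective⇒MGS {∅} λ ()
      ; hereditary = λ {A} {B} A⊆B B-mgs → sourceInjective⇒MGS {A} λ e∈A f∈A →
          MGS⇒sourceInjective {B} B-mgs (A⊆B e∈A) (A⊆B f∈A)
      ; exchange   = exchange
      }
      where
      open FiniteSubset edge-finite
      open FiniteSubsetProperties edge-finite

      exchange : ∀ {A B} → MGS L A → MGS L B → ∣ A ∣ ℕ.< ∣ B ∣ →
        ∃ λ e → e ∈ ⟦ B ⟧ × e ∉ ⟦ A ⟧ × MGS L (A ∪⁅ e ⁆)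
      exchange {A} {B} A-mgs B-mgs ∣A∣<∣B∣
        -- The edge chosen has a source not occurring in `A`, so adjoining it keeps sources
        -- distinct.
        with exchange-injectiveOn _≟_ source {A} {B} (MGS⇒sourceInjective {B} B-mgs) ∣A∣<∣B∣
      ... | e , e∈B , new = e , e∈B , (λ e∈A → new e∈A refl) , sourceInjective⇒MGS injective
        where
        injective : SourceInjective (A ∪⁅ e ⁆)
        injective f∈ g∈ s≡s with ∪⁅⁆⁻ A e f∈ | ∪⁅⁆⁻ A e g∈
        ... | inj₁ f∈A  | inj₁ g∈A  = MGS⇒sourceInjective {A} A-mgs f∈A g∈A s≡s
        ... | inj₁ f∈A  | inj₂ refl = contradiction s≡s (new f∈A)
        ... | inj₂ refl | inj₁ g∈A  = contradiction (sym s≡s) (new g∈A)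
        ... | inj₂ refl | inj₂ refl = refl

    -- Finite total orders as chains, by rank.

    total⇒isLinearOrder : IsLinearOrder L
    total⇒isLinearOrder = size (proj₁ finite) refl
      where
      open FiniteSet finite using (to; from)
      open FiniteSubset finite
      open FiniteSubsetProperties finite

      -- The strict down-set of `x`; its cardinality is the rank of `x`, the position of `x` in the
      -- chain counted from 0.
      below : Carrier → Subset Carrier
      below x y = does ((y ≤? x) ×-dec ¬? (y ≟ x))

      below⁺ : ∀ {x y} → y ≤ x → y ≢ x → y ∈ ⟦ below x ⟧
      below⁺ {x} {y} y≤x y≢x = T-does⁺ ((y ≤? x) ×-dec ¬? (y ≟ x)) (y≤x , y≢x)

      below⁻ : ∀ {x y} → y ∈ ⟦ below x ⟧ → y ≤ x × y ≢ x
      below⁻ {x} {y} = T-does⁻ ((y ≤? x) ×-dec ¬? (y ≟ x))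

      below-mono : ∀ {x y} → x ≤ y → ⟦ below x ⟧ ⊆ ⟦ below y ⟧
      below-mono x≤y z∈ with below⁻ z∈
      ... | z≤x , z≢x = below⁺ (≤-trans z≤x x≤y) λ { refl → z≢x (antisym z≤x x≤y) }

      rank-< : ∀ {x y} → x ≤ y → x ≢ y → ∣ below x ∣ ℕ.< ∣ below y ∣
      rank-< {x} {y} x≤y x≢y = ∣∣<∣∣ {below x} {below y} (below-mono x≤y) (below⁺ x≤y x≢y)
        (λ x∈ → proj₂ (below⁻ {x} x∈) refl)

      -- By totality, failure of `x ≤ y` means `y` is strictly below `x`, and strict monotonicity of
      -- the rank then contradicts the hypothesis.
      rank-cancel : ∀ {x y} → ∣ below x ∣ ℕ.≤ ∣ below y ∣ → x ≤ y
      rank-cancel {x} {y} r≤r with total x y | x ≟ y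
      ... | inj₁ x≤y | _        = x≤y
      ... | inj₂ _   | yes refl = ≤-refl
      ... | inj₂ y≤x | no x≢y   = contradiction r≤r (ℕ.<⇒≱ (rank-< y≤x (x≢y ∘ sym)))

      rank-mono : ∀ {x y} → x ≤ y → ∣ below x ∣ ℕ.≤ ∣ below y ∣
      rank-mono {x} {y} x≤y with x ≟ y
      ... | yes refl = ℕ.≤-refl
      ... | no x≢y   = ℕ.<⇒≤ (rank-< x≤y x≢y)

      rank-bound : ∀ x → ∣ below x ∣ ℕ.< proj₁ finite
      rank-bound x = ℕ.<-≤-trans
        -- The bound is strict because `x` lies in the full set but not strictly below itself.
        (∣∣<∣∣ {below x} {λ _ → true} {x} (λ _ → _) _ (λ x∈ → proj₂ (below⁻ {x} x∈) refl))
        (ℕ.≤-trans (∣∣≤length (λ _ → true) id (λ _ → ∈-universe _) (λ _ _ → id))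
          (ℕ.≤-reflexive (length-tabulate from)))

      rank : Carrier → Fin (proj₁ finite)
      rank x = Fin.fromℕ< (rank-bound x)

      rank≤⁺ : ∀ {x y} → x ≤ y → rank x Fin.≤ rank y
      rank≤⁺ {x} {y} x≤y = subst₂ ℕ._≤_
        (sym (Fin.toℕ-fromℕ< (rank-bound x))) (sym (Fin.toℕ-fromℕ< (rank-bound y))) (rank-mono x≤y)

      rank≤⁻ : ∀ {x y} → rank x Fin.≤ rank y → x ≤ y
      rank≤⁻ {x} {y} r≤r = rank-cancel (subst₂ ℕ._≤_
        (Fin.toℕ-fromℕ< (rank-bound x)) (Fin.toℕ-fromℕ< (rank-bound y)) r≤r)

      rank-injective : Injective _≡_ _≡_ rank
      rank-injective eq = antisym (rank≤⁻ (Fin.≤-reflexive eq)) (rank≤⁻ (Fin.≤-reflexive (sym eq)))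

      rank-surjective : Surjective _≡_ _≡_ rank
      rank-surjective j with injective⇒surjective {f = rank ∘ from}
        (Injection.injective (↔⇒↣ (↔-sym (proj₂ finite))) ∘ rank-injective) j
      ... | i , eq = from i , λ { refl → eq }

      rank-isOrderIsomorphism : IsOrderIsomorphism _≡_ _≡_ _≤_ Fin._≤_ rank
      rank-isOrderIsomorphism = record
        { isOrderMonomorphism = record
          { isOrderHomomorphism = record { cong = cong rank ; mono = rank≤⁺ }
          ; injective           = rank-injective
          ; cancel              = rank≤⁻
          }
        ; surjective = rank-surjective
        }

      -- The cardinality is generalised to `n` so that it can be split: nonemptiness excludes zero,
      -- and a lattice of `suc n` elements is the chain with top index `n`.
      size : ∀ n → proj₁ finite ≡ n → IsLinearOrder L
      size ℕ.zero    eq = contradiction (subst Fin eq (to nonempty)) λ ()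
      size (ℕ.suc n) eq = n , subst
        (λ k → ∃ λ (f : Carrier → Fin k) → IsOrderIsomorphism _≡_ _≡_ _≤_ Fin._≤_ f)
        eq (rank , rank-isOrderIsomorphism)

  isLinearOrder⇒total : IsLinearOrder L → Total _≤_
  isLinearOrder⇒total (_ , f , f-iso) x y with Fin.≤-total (f x) (f y)
  ... | inj₁ fx≤fy = inj₁ (IsOrderIsomorphism.cancel f-iso fx≤fy)
  ... | inj₂ fy≤fx = inj₂ (IsOrderIsomorphism.cancel f-iso fy≤fx)

  -- Matroidal lattices are totally ordered.

  matroidal⇒comparable : Matroidal L → ∀ {x y} → ¬ x ≤ y → ¬ ¬ y ≤ x
  matroidal⇒comparable matroid {x} {y} x≰y y≰x = exchange-fails (exchange single-mgs pair-mgs card)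
    where
    -- Cardinalities here use the enumeration of edges carried by `matroid`, the one to which
    -- `exchange` refers.
    open IsMatroid matroid using (exchange; ∣_∣; _∪⁅_⁆) renaming (finite to edges-finite)
    open FiniteSubsetProperties edges-finite

    m j : Carrier
    m = x ∧ y
    j = x ∨ y

    m≢x : m ≢ x
    m≢x m≡x = x≰y (subst (_≤ y) m≡x (x∧y≤y x y))

    m≢y : m ≢ y
    m≢y m≡y = y≰x (subst (_≤ x) m≡y (x∧y≤x x y))

    m→j m→x m→y : Edge L
    m→j = edge m j (≤-trans (x∧y≤x x y) (x≤x∨y x y))
      -- If `m` were `j`, then `x` would be squeezed between them and equal `m`.
      (λ m≡j → m≢x (antisym (x∧y≤x x y) (subst (x ≤_) (sym m≡j) (x≤x∨y x y))))
    m→x = edge m x (x∧y≤x x y) m≢x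
    m→y = edge m y (x∧y≤y x y) m≢y

    single pair : Subset (Edge L)
    single = ∅ ∪⁅ m→j ⁆
    pair   = ∅ ∪⁅ m→x ⁆ ∪⁅ m→y ⁆

    single⁻ : ∀ {e} → e ∈ ⟦ single ⟧ → e ≡ m→j
    single⁻ e∈ with ∪⁅⁆⁻ ∅ m→j e∈
    ... | inj₂ e≡ = e≡

    pair⁻ : ∀ {e} → e ∈ ⟦ pair ⟧ → e ≡ m→x ⊎ e ≡ m→y
    pair⁻ e∈ with ∪⁅⁆⁻ (∅ ∪⁅ m→x ⁆) m→y e∈
    ... | inj₂ e≡ = inj₂ e≡
    ... | inj₁ e∈′ with ∪⁅⁆⁻ ∅ m→x e∈′
    ...   | inj₂ e≡ = inj₁ e≡

    single-mgs : MGS L single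
    -- The agreement condition is vacuous: a singleton has no two distinct edges.
    single-mgs = ∧-agreeing⇒MGS λ e∈ f∈ f≢e →
      contradiction (trans (single⁻ f∈) (sym (single⁻ e∈))) f≢e

    -- Meeting with `x` sends both ends of `m→y` to `m`, and meeting with `y` does the same to
    -- `m→x`.
    pair-mgs : MGS L pair
    pair-mgs = ∧-agreeing⇒MGS agree
      where
      agree : ∀ {e f} → e ∈ ⟦ pair ⟧ → f ∈ ⟦ pair ⟧ → f ≢ e →
        source f ∧ target e ≡ target f ∧ target e
      agree e∈ f∈ f≢e with pair⁻ e∈ | pair⁻ f∈
      ... | inj₁ refl | inj₁ refl = contradiction refl f≢e
      ... | inj₁ refl | inj₂ refl = trans (x≤y⇒x∧y≡x (x∧y≤x x y)) (∧-comm x y)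
      ... | inj₂ refl | inj₁ refl = x≤y⇒x∧y≡x (x∧y≤y x y)
      ... | inj₂ refl | inj₂ refl = contradiction refl f≢e

    card : ∣ single ∣ ℕ.< ∣ pair ∣
    -- One-element and two-element lists bound the cardinalities from above and below; `2 ≤ n` is
    -- `1 < n` by definition.
    card = ℕ.≤-<-trans
      (∣∣≤length single {m→j ∷ []} id (λ e∈ → here (single⁻ e∈)) (λ _ _ → id))
      (length≤∣∣ {m→x ∷ m→y ∷ []} pair (((m→x≢m→y ∷ []) ∷ [] ∷ []))
        λ { (here refl)         → ∪⁅⁆⁺ˡ (∅ ∪⁅ m→x ⁆) m→y (∪⁅⁆⁺ʳ ∅ m→x)
          ; (there (here refl)) → ∪⁅⁆⁺ʳ (∅ ∪⁅ m→x ⁆) m→y })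
      where
      m→x≢m→y : m→x ≢ m→y
      m→x≢m→y eq = x≰y (subst (x ≤_) (cong target eq) ≤-refl)

    -- Whichever edge of `pair` is adjoined, it is the restriction of `m→j` along its own target,
    -- hence redundant.
    exchange-fails : ¬ (∃ λ e → e ∈ ⟦ pair ⟧ × e ∉ ⟦ single ⟧ × MGS L (single ∪⁅ e ⁆))
    exchange-fails (e , e∈pair , e∉single , mgs) =
      restriction⇒¬MGS {single ∪⁅ e ⁆} {e} {m→j}
        (∪⁅⁆⁺ʳ single e) (∪⁅⁆⁺ˡ single e m→j∈single)
        (λ e≡m→j → e∉single (subst (_∈ ⟦ single ⟧) (sym e≡m→j) m→j∈single))
        (proj₁ (restricts e∈pair)) (proj₂ (restricts e∈pair)) mgs
      where
      m→j∈single : m→j ∈ ⟦ single ⟧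
      m→j∈single = ∪⁅⁆⁺ʳ ∅ m→j

      restricts : ∀ {e} → e ∈ ⟦ pair ⟧ → m ∧ target e ≡ source e × j ∧ target e ≡ target e
      restricts e∈ with pair⁻ e∈
      ... | inj₁ refl = x≤y⇒x∧y≡x (x∧y≤x x y) , y≤x⇒x∧y≈y (x≤x∨y x y)
      ... | inj₂ refl = x≤y⇒x∧y≡x (x∧y≤y x y) , y≤x⇒x∧y≈y (y≤x∨y x y)

  matroidal⇒total : Matroidal L → Total _≤_
  matroidal⇒total matroid x y with x ≤? y | y ≤? x
  ... | yes x≤y | _       = inj₁ x≤y
  ... | no _    | yes y≤x = inj₂ y≤x
  ... | no x≰y  | no y≰x  = contradiction y≰x (matroidal⇒comparable matroid x≰y)

theorem1p5 : ∀ {c ℓ : Level} (L : FiniteLattice c ℓ) → Matroidal L ⇔ IsLinearOrder L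
theorem1p5 L = mk⇔
  (total⇒isLinearOrder L ∘ matroidal⇒total L)
  (total⇒matroidal L ∘ isLinearOrder⇒total L)
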